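{- Let $0\le d\le n$ be integers, let $\mathcal{H}$ be a $k$-uniform family of subsets of $[n]=\{1,\dots,n\}$ (i.e. $|F|=k$ for all $F\in\mathcal{H}$), and let $\mathbb{F}$ be a field. Suppose there exists a polynomial $P(\mathbf{x},\mathbf{y})\in\mathbb{F}[x_1,\dots,x_n,y_1,\dots,y_n]$ of total degree at most $d$ such that $P(\mathbf{v}_F,\mathbf{v}_F)\ne 0$ for every $F\in\mathcal{H}$ and $P(\mathbf{v}_F,\mathbf{v}_G)=0$ for all $F\ne G$ in $\mathcal{H}$. Then \[ |\mathcal{H}|\le 2\binom{n}{\lfloor d/2\rfloor}. \]
   Context: For $F\subseteq[n]$, $\mathbf{v}_F\in\{0,1\}^n\subseteq\mathbb{F}^n$ denotes the characteristic vector of $F$ (its $i$-th coordinate is $1$ iff $i\in F$). -}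

module Defs where

open import Level using (Level; _⊔_; suc)
open import Data.Nat as ℕ using (ℕ)
open import Data.Fin using (Fin)
open import Data.Bool using (if_then_else_)
open import Data.Vec using (lookup; _++_)
open import Data.List using (List; foldr)
open import Data.List.Relation.Unary.All using (All)
open import Data.Product using (Σ; _×_)
open import Data.Fin.Subset using (Subset)
open import Relation.Nullary using (¬_)
open import Algebra.Bundles using (CommutativeRing)

record Field (c ℓ : Level) : Set (suc (c ⊔ ℓ)) where
  field
    commutativeRing : CommutativeRing c ℓ
  open CommutativeRing commutativeRing public
  field
    0≉1     : ¬ (0# ≈ 1#)
    inverse : ∀ x → ¬ (x ≈ 0#) → Σ Carrier λ y → (x * y) ≈ 1#

module _ {c ℓ : Level} (𝔽 : Field c ℓ) where
  open Field 𝔽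

  Monomial : ℕ → Set c
  Monomial m = Carrier × (Fin m → ℕ)

  Poly : ℕ → Set c
  Poly m = List (Monomial m)

  expDeg : {m : ℕ} → (Fin m → ℕ) → ℕ
  expDeg {ℕ.zero}  e = 0
  expDeg {ℕ.suc m} e = e Data.Fin.zero ℕ.+ expDeg (λ i → e (Data.Fin.suc i))

  DegreeAtMost : {m : ℕ} → ℕ → Poly m → Set c
  DegreeAtMost d P = All (λ t → expDeg (Data.Product.proj₂ t) ℕ.≤ d) P

  pow : Carrier → ℕ → Carrier
  pow x ℕ.zero    = 1#
  pow x (ℕ.suc k) = x * pow x k

  evalMono : {m : ℕ} → (Fin m → ℕ) → (Fin m → Carrier) → Carrier
  evalMono {ℕ.zero}  e x = 1#
  evalMono {ℕ.suc m} e x =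
    pow (x Data.Fin.zero) (e Data.Fin.zero) * evalMono (λ i → e (Data.Fin.suc i)) (λ i → x (Data.Fin.suc i))

  eval : {m : ℕ} → Poly m → (Fin m → Carrier) → Carrier
  eval P x = foldr (λ t acc → (Data.Product.proj₁ t * evalMono (Data.Product.proj₂ t) x) + acc) 0# P

  charVec : {n : ℕ} → Subset n → Fin n → Carrier
  charVec F i = if lookup F i then 1# else 0#

  -- Evaluation of P(x, y) ∈ 𝔽[x₁..xₙ, y₁..yₙ] at (v_F, v_G):
  -- variables 0..n-1 are the x's, n..2n-1 are the y's.
  eval₂ : {n : ℕ} → Poly (n ℕ.+ n) → Subset n → Subset n → Carrier
  eval₂ P F G = eval P (lookup (Data.Vec.tabulate (charVec F) ++ Data.Vec.tabulate (charVec G)))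

{-# OPTIONS --safe #-}
module Submission where

-- The matrix M(F, G) = P(v_F, v_G), F, G ∈ ℋ, is diagonal with nonzero diagonal, so |ℋ| is at most
-- its rank.  Each monomial of P has degree at most e = ⌊d/2⌋ in x or in y (Croot–Lev–Pach), so the
-- rank is at most twice the dimension of the space of functions of degree at most e on the slice
-- {F : |F| = k}.  That dimension is at most C(n, e) over any field: modulo the functions
-- u(S) = Σ_{T ⊇ S, |T| = e} x_T with |S| < e, which are multiples of x_S on the slice and so have
-- lower degree, every x_T with |T| = e is a combination of x_B for ballot sets B of size e.  This
-- goes by induction on n, splitting off a coordinate; when n < 2e no B is needed, because
-- Σ_{S ⊆ T} (−1)^|S| u(S) sums x_U over the e-sets U disjoint from T, and there are none.
-- For 2e ≤ n there are C(n, e) − C(n, e − 1) ballot sets of size e.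

open import Defs
open import Level using (Level; _⊔_)
open import Data.Nat using (ℕ; zero; suc; _≤_; _<_; _*_; _/_; z≤n; s≤s; _≤?_; _<?_)
import Data.Nat as ℕ
import Data.Nat.Properties as ℕₚ
import Data.Nat.DivMod as ℕ
open import Data.Nat.Combinatorics using (_C_; nCk+nC[k+1]≡[n+1]C[k+1]; nCk≡nC[n∸k])
open import Data.Nat.Solver using (module +-*-Solver)
open import Data.Bool using (true; false; if_then_else_)
open import Data.Fin using (Fin; zero; suc; punchIn; _↑ˡ_; _↑ʳ_)
open import Data.Fin.Properties using (punchIn-injective; punchInᵢ≢i)
open import Data.Fin.Subset using (Subset; ∣_∣; inside; outside)
open import Data.List using (List; []; _∷_; length; map; _++_)
import Data.List as List
open import Data.List.Properties using (length-++; length-map)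
open import Data.List.Membership.Propositional using (_∈_)
open import Data.List.Membership.Propositional.Properties using (∈-++⁺ˡ; ∈-++⁺ʳ; ∈-map⁺; ∈-lookup)
open import Data.List.Relation.Unary.All using ([]; _∷_)
open import Data.List.Relation.Unary.AllPairs using ([]; _∷_)
import Data.List.Relation.Unary.All as All
open import Data.List.Relation.Unary.Any using (here; index)
open import Data.List.Relation.Unary.Any.Properties using (lookup-index)
open import Data.List.Relation.Unary.Unique.Propositional using (Unique)
open import Data.Product using (Σ; _×_; _,_; proj₁; proj₂)
open import Data.Sum using (_⊎_; inj₁; inj₂)
open import Data.Vec using ([]; _∷_; head; tail; tabulate)
import Data.Vec as Vec
import Data.Vec.Functional as Vector
open import Data.Vec.Functional.Properties using (lookup-++ˡ; lookup-++ʳ)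
open import Function using (_∘_)
open import Relation.Binary.PropositionalEquality as ≡ using (_≡_; _≢_; cong; subst)
open import Relation.Nullary using (¬_; yes; no; contradiction)
open import Relation.Nullary.Decidable using (decidable-stable)
import Algebra.Properties.Ring
import Algebra.Properties.Semiring.Sum
import Algebra.Solver.Ring.NaturalCoefficients.Default
import Relation.Binary.Reasoning.Setoid

-- Ballot sets and their number.

-- The subsets of size e whose i-th smallest element is at least 2i for every i; coordinates are
-- numbered from the end of the vector.
ballot : (n e : ℕ) → List (Subset n)
ballot zero    zero    = [] ∷ []
ballot zero    (suc e) = []
ballot (suc n) zero    = map (outside ∷_) (ballot n zero)
ballot (suc n) (suc e) with suc e ℕ.+ suc e ≤? suc n
... | yes _ = map (outside ∷_) (ballot n (suc e)) ++ map (inside ∷_) (ballot n e)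
... | no  _ = []

ballot-outside : ∀ {n} e {S} → e ℕ.+ e ≤ suc n → S ∈ ballot n e → outside ∷ S ∈ ballot (suc n) e
ballot-outside zero _ S∈ = ∈-map⁺ (outside ∷_) S∈
ballot-outside {n} (suc e) le S∈ with suc e ℕ.+ suc e ≤? suc n
... | yes _ = ∈-++⁺ˡ (∈-map⁺ (outside ∷_) S∈)
... | no ¬le = contradiction le ¬le

ballot-inside : ∀ {n} e {S} → suc e ℕ.+ suc e ≤ suc n → S ∈ ballot n e →
                inside ∷ S ∈ ballot (suc n) (suc e)
ballot-inside {n} e le S∈ with suc e ℕ.+ suc e ≤? suc n
... | yes _ = ∈-++⁺ʳ (map (outside ∷_) (ballot n (suc e))) (∈-map⁺ (inside ∷_) S∈)
... | no ¬le = contradiction le ¬le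

length-ballot-zero : ∀ n → length (ballot n 0) ≡ 1
length-ballot-zero zero    = ≡.refl
length-ballot-zero (suc n) = ≡.trans (length-map (outside ∷_) (ballot n 0)) (length-ballot-zero n)

central-binomial : ∀ n e → n ≡ e ℕ.+ e → suc n C e ≡ suc n C suc e
central-binomial n e ≡.refl = ≡.trans (nCk≡nC[n∸k] (ℕₚ.m≤n⇒m≤1+n (ℕₚ.m≤m+n e e)))
  (cong (suc (e ℕ.+ e) C_) (ℕₚ.m+n∸n≡m (suc e) e))

-- Pascal's rule matches the recursion of `ballot`. The hypothesis admits 2(e + 1) = n + 1, a
-- boundary that the induction on n reaches: there no ballot set is left, and the two binomials are
-- the equal middle entries of their row.
length-ballot-suc : ∀ n e → suc e ℕ.+ suc e ≤ suc n →
                    length (ballot n (suc e)) ℕ.+ n C e ≤ n C suc e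
length-ballot-suc zero e le = contradiction
  (ℕₚ.≤-trans (ℕₚ.≤-reflexive (≡.sym (ℕₚ.+-suc e e))) (ℕₚ.≤-pred le)) λ ()
length-ballot-suc (suc n) e le with suc e ℕ.+ suc e ≤? suc n
... | no ¬le = ℕₚ.≤-reflexive (central-binomial n e (ℕₚ.suc-injective (ℕₚ.suc-injective
      (≡.trans (≡.sym (ℕₚ.≤-antisym le (ℕₚ.≰⇒> ¬le))) (cong suc (ℕₚ.+-suc e e))))))
... | yes le′ = begin
  length (map (outside ∷_) (ballot n (suc e)) ++ map (inside ∷_) (ballot n e)) ℕ.+ suc n C e
    ≡⟨ cong (ℕ._+ suc n C e) (≡.trans (length-++ (map (outside ∷_) (ballot n (suc e))))
         (≡.cong₂ ℕ._+_ (length-map _ (ballot n (suc e))) (length-map _ (ballot n e)))) ⟩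
  length (ballot n (suc e)) ℕ.+ length (ballot n e) ℕ.+ suc n C e
    ≤⟨ step e le′ ⟩
  n C e ℕ.+ n C suc e
    ≡⟨ nCk+nC[k+1]≡[n+1]C[k+1] n e ⟩
  suc n C suc e ∎
  where
  open ℕₚ.≤-Reasoning
  step : ∀ e → suc e ℕ.+ suc e ≤ suc n →
         length (ballot n (suc e)) ℕ.+ length (ballot n e) ℕ.+ suc n C e ≤ n C e ℕ.+ n C suc e
  step zero le = begin
    length (ballot n 1) ℕ.+ length (ballot n 0) ℕ.+ 1
      ≡⟨ cong (λ x → length (ballot n 1) ℕ.+ x ℕ.+ 1) (length-ballot-zero n) ⟩
    length (ballot n 1) ℕ.+ 1 ℕ.+ 1
      ≤⟨ ℕₚ.+-monoˡ-≤ 1 (length-ballot-suc n 0 le) ⟩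
    n C 1 ℕ.+ 1
      ≡⟨ ℕₚ.+-comm (n C 1) 1 ⟩
    1 ℕ.+ n C 1 ∎
  step (suc e) le = begin
    length (ballot n (suc (suc e))) ℕ.+ length (ballot n (suc e)) ℕ.+ suc n C suc e
      ≡⟨ cong (length (ballot n (suc (suc e))) ℕ.+ length (ballot n (suc e)) ℕ.+_)
           (≡.sym (nCk+nC[k+1]≡[n+1]C[k+1] n e)) ⟩
    length (ballot n (suc (suc e))) ℕ.+ length (ballot n (suc e)) ℕ.+ (n C e ℕ.+ n C suc e)
      ≡⟨ solve 4 (λ a b c d → a :+ b :+ (c :+ d) := (b :+ c) :+ (a :+ d)) ≡.refl
           (length (ballot n (suc (suc e)))) (length (ballot n (suc e))) (n C e) (n C suc e) ⟩
    (length (ballot n (suc e)) ℕ.+ n C e) ℕ.+ (length (ballot n (suc (suc e))) ℕ.+ n C suc e)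
      ≤⟨ ℕₚ.+-mono-≤
           (length-ballot-suc n e (ℕₚ.≤-trans (ℕₚ.+-mono-≤ (ℕₚ.n≤1+n (suc e)) (ℕₚ.n≤1+n (suc e))) le))
           (length-ballot-suc n (suc e) le) ⟩
    n C suc e ℕ.+ n C suc (suc e) ∎
    where open +-*-Solver

ballots≤ : (n e : ℕ) → List (Subset n)
ballots≤ n zero    = ballot n zero
ballots≤ n (suc e) = ballot n (suc e) ++ ballots≤ n e

-- Telescoping: `n C e` bounds the smaller sizes, and `length-ballot-suc` leaves that much room
-- below `n C suc e`.
length-ballots≤ : ∀ n e → e ℕ.+ e ≤ suc n → length (ballots≤ n e) ≤ n C e
length-ballots≤ n zero    _  = ℕₚ.≤-reflexive (length-ballot-zero n)
length-ballots≤ n (suc e) le = begin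
  length (ballot n (suc e) ++ ballots≤ n e)
    ≡⟨ length-++ (ballot n (suc e)) ⟩
  length (ballot n (suc e)) ℕ.+ length (ballots≤ n e)
    ≤⟨ ℕₚ.+-monoʳ-≤ (length (ballot n (suc e)))
         (length-ballots≤ n e (ℕₚ.≤-trans (ℕₚ.+-mono-≤ (ℕₚ.n≤1+n e) (ℕₚ.n≤1+n e)) le)) ⟩
  length (ballot n (suc e)) ℕ.+ n C e
    ≤⟨ length-ballot-suc n e le ⟩
  n C suc e ∎
  where open ℕₚ.≤-Reasoning

-- Positions in duplicate-free lists, and halving a degree.

lookup-injective : ∀ {a} {A : Set a} {xs : List A} → Unique xs → ∀ i j →
                   List.lookup xs i ≡ List.lookup xs j → i ≡ j
lookup-injective (_ ∷ _)   zero    zero    _  = ≡.refl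
lookup-injective (x∉ ∷ _)  zero    (suc j) eq = contradiction eq (All.lookup x∉ (∈-lookup j))
lookup-injective (x∉ ∷ _)  (suc i) zero    eq = contradiction (≡.sym eq) (All.lookup x∉ (∈-lookup i))
lookup-injective (_ ∷ uxs) (suc i) (suc j) eq = cong suc (lookup-injective uxs i j eq)

-- Two numbers above ⌊d/2⌋ have sum at least 2⌊d/2⌋ + 2, which exceeds d.
half-≤ : ∀ {d} a b → a ℕ.+ b ≤ d → a ≤ d / 2 ⊎ b ≤ d / 2
half-≤ {d} a b le with a ≤? d / 2 | b ≤? d / 2
... | yes a≤ | _      = inj₁ a≤
... | no _   | yes b≤ = inj₂ b≤
... | no a≰  | no b≰  = contradiction le (ℕₚ.<⇒≱ (begin-strict
  d                                 <⟨ d< ⟩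
  suc (d / 2) ℕ.+ suc (d / 2)       ≤⟨ ℕₚ.+-mono-≤ (ℕₚ.≰⇒> a≰) (ℕₚ.≰⇒> b≰) ⟩
  a ℕ.+ b                           ∎))
  where
  open ℕₚ.≤-Reasoning
  d< : d < suc (d / 2) ℕ.+ suc (d / 2)
  d< = begin-strict
    d                            ≡⟨ ℕ.m≡m%n+[m/n]*n d 2 ⟩
    d ℕ.% 2 ℕ.+ d / 2 * 2        <⟨ ℕₚ.+-monoˡ-< (d / 2 * 2) (ℕ.m%n<n d 2) ⟩
    2 ℕ.+ d / 2 * 2              ≡⟨ ℕₚ.*-comm (suc (d / 2)) 2 ⟩
    2 * suc (d / 2)              ≡⟨ cong (suc (d / 2) ℕ.+_) (ℕₚ.+-identityʳ _) ⟩
    suc (d / 2) ℕ.+ suc (d / 2)  ∎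

module _ {c ℓ : Level} (𝔽 : Field c ℓ) where

  open Field 𝔽 using
    ( Carrier; _≈_; _+_; -_; 0#; 1#; inverse
        ; setoid; ring; semiring; commutativeSemiring; refl; sym; trans; reflexive
    ; +-cong; +-congˡ; +-congʳ; +-comm; +-identityˡ; +-identityʳ; -‿cong; -‿inverseˡ; -‿inverseʳ; +-assoc
    ; *-cong; *-congˡ; *-congʳ; *-identityˡ; *-identityʳ; *-assoc; *-comm; zeroˡ; zeroʳ; distribˡ; distribʳ )
    renaming (_*_ to infixl 7 _·_)
  open Algebra.Properties.Ring ring using (-0#≈0#; -‿distribˡ-*; -‿+-comm; -1*x≈-x)
  open Algebra.Properties.Semiring.Sum semiring using
    (sum; sum-cong-≋; *-distribˡ-sum; ∑-distrib-+; sum-replicate-zero)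
  open Algebra.Solver.Ring.NaturalCoefficients.Default commutativeSemiring using (solve; _:+_; _:*_; _:=_)
  open Relation.Binary.Reasoning.Setoid setoid

  -- Field arithmetic and finite sums.

  +-zero : ∀ {x y} → x ≈ 0# → y ≈ 0# → x + y ≈ 0#
  +-zero x≈0 y≈0 = trans (+-cong x≈0 y≈0) (+-identityˡ 0#)

  *-zeroˡ : ∀ {x} y → x ≈ 0# → x · y ≈ 0#
  *-zeroˡ y x≈0 = trans (*-congʳ x≈0) (zeroˡ y)

  *-zeroʳ : ∀ x {y} → y ≈ 0# → x · y ≈ 0#
  *-zeroʳ x y≈0 = trans (*-congˡ y≈0) (zeroʳ x)

  x+y-y : ∀ x y → (x + y) + - y ≈ x
  x+y-y x y = trans (+-assoc x y (- y)) (trans (+-congˡ (-‿inverseʳ y)) (+-identityʳ x))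

  x≈y+z⇒y≈x-z : ∀ {x y z} → x ≈ y + z → y ≈ x + - z
  x≈y+z⇒y≈x-z {x} {y} {z} eq = trans (sym (x+y-y y z)) (+-congʳ (sym eq))

  unit : ∀ {N} → Fin N → Fin N → Carrier
  unit zero    zero    = 1#
  unit zero    (suc _) = 0#
  unit (suc _) zero    = 0#
  unit (suc i) (suc j) = unit i j

  sum-zero : ∀ {N} (f : Fin N → Carrier) → (∀ t → f t ≈ 0#) → sum f ≈ 0#
  sum-zero {N} f f≈0 = trans (sum-cong-≋ f≈0) (sum-replicate-zero N)

  sum-unit : ∀ {N} i (f : Fin N → Carrier) → sum (λ t → unit i t · f t) ≈ f i
  sum-unit zero    f = trans (+-cong (*-identityˡ _) (sum-zero (λ t → 0# · f (suc t)) λ t → zeroˡ _)) (+-identityʳ _)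
  sum-unit (suc i) f = trans (+-cong (zeroˡ _) (sum-unit i (f ∘ suc))) (+-identityˡ _)

  -- Linear spans of functions.

  module _ {X : Set} where

    -- The inductive form gives closure under linear operations without handling coordinates, for
    -- any index set; `coefficients` recovers coordinates when the index set is finite. Functions
    -- are compared pointwise up to `≈`, hence `respₛ`.
    data Span {I : Set} (g : I → X → Carrier) : (X → Carrier) → Set (c ⊔ ℓ) where
      gen    : ∀ i → Span g (g i)
      zeroₛ  : Span g (λ _ → 0#)
      _+ₛ_   : ∀ {φ ψ} → Span g φ → Span g ψ → Span g (λ x → φ x + ψ x)
      _*ₛ_   : ∀ a {φ} → Span g φ → Span g (λ x → a · φ x)
      respₛ  : ∀ {φ ψ} → (∀ x → φ x ≈ ψ x) → Span g φ → Span g ψ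

    -ₛ_ : ∀ {I : Set} {g : I → X → Carrier} {φ} → Span g φ → Span g (λ x → - φ x)
    -ₛ s = respₛ (λ x → -1*x≈-x _) ((- 1#) *ₛ s)

    coefficients : ∀ {N} {g : Fin N → X → Carrier} {φ} → Span g φ →
                   Σ (Fin N → Carrier) λ α → ∀ x → φ x ≈ sum (λ t → α t · g t x)
    coefficients {g = g} (gen i) = unit i , λ x → sym (sum-unit i (λ t → g t x))
    coefficients {g = g} zeroₛ = (λ _ → 0#) , λ x → sym (sum-zero (λ t → 0# · g t x) λ t → zeroˡ _)
    coefficients {g = g} (s +ₛ s′) with coefficients s | coefficients s′
    ... | α , p | β , q = (λ t → α t + β t) , λ x → begin
      _                                                         ≈⟨ +-cong (p x) (q x) ⟩
      sum (λ t → α t · g t x) + sum (λ t → β t · g t x)         ≈⟨ ∑-distrib-+ (λ t → α t · g t x) (λ t → β t · g t x) ⟨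
      sum (λ t → α t · g t x + β t · g t x)                     ≈⟨ sum-cong-≋ (λ t → distribʳ (g t x) (α t) (β t)) ⟨
      sum (λ t → (α t + β t) · g t x)                           ∎
    coefficients {g = g} (a *ₛ s) with coefficients s
    ... | α , p = (λ t → a · α t) , λ x → begin
      _                                   ≈⟨ *-congˡ (p x) ⟩
      a · sum (λ t → α t · g t x)         ≈⟨ *-distribˡ-sum a (λ t → α t · g t x) ⟩
      sum (λ t → a · (α t · g t x))       ≈⟨ sum-cong-≋ (λ t → *-assoc a (α t) (g t x)) ⟨
      sum (λ t → a · α t · g t x)         ∎
    coefficients (respₛ eq s) with coefficients s
    ... | α , p = α , λ x → trans (sym (eq x)) (p x)

  -- The map sending φ to w · (φ ∘ r) is linear, so generators suffice.
  weighted-pullback : ∀ {X Y I J : Set} {g : I → X → Carrier} {h : J → Y → Carrier}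
                      (w : Y → Carrier) (r : Y → X) →
                      (∀ i → Span h (λ y → w y · g i (r y))) →
                      ∀ {φ} → Span g φ → Span h (λ y → w y · φ (r y))
  weighted-pullback w r G (gen i)      = G i
  weighted-pullback w r G zeroₛ        = respₛ (λ y → sym (zeroʳ _)) zeroₛ
  weighted-pullback w r G (s +ₛ s′)    =
    respₛ (λ y → sym (distribˡ _ _ _)) (weighted-pullback w r G s +ₛ weighted-pullback w r G s′)
  weighted-pullback w r G (_*ₛ_ a {φ} s) =
    respₛ (λ y → solve 3 (λ a w z → a :* (w :* z) := w :* (a :* z)) refl a (w y) (φ (r y)))
      (a *ₛ weighted-pullback w r G s)
  weighted-pullback w r G (respₛ eq s) = respₛ (λ y → *-congˡ (eq (r y))) (weighted-pullback w r G s)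

  pullback : ∀ {X Y I J : Set} {g : I → X → Carrier} {h : J → Y → Carrier} (r : Y → X) →
             (∀ i → Span h (g i ∘ r)) → ∀ {φ} → Span g φ → Span h (φ ∘ r)
  pullback r G s = respₛ (λ y → *-identityˡ _)
    (weighted-pullback (λ _ → 1#) r (λ i → respₛ (λ y → sym (*-identityˡ _)) (G i)) s)

  -- Set monomials and their upward sums.

  -- This is the indicator of S ⊆ F, the value of the multilinear monomial x_S at v_F.
  mono : ∀ {n} → Subset n → Subset n → Carrier
  mono []            []          = 1#
  mono (outside ∷ S) (b ∷ F)     = mono S F
  mono (inside ∷ S)  (true ∷ F)  = mono S F
  mono (inside ∷ S)  (false ∷ F) = 0#

  mono-vanish : ∀ {n} (S F : Subset n) → ∣ F ∣ < ∣ S ∣ → mono S F ≈ 0#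
  mono-vanish []            []          ()
  mono-vanish (outside ∷ S) (true ∷ F)  lt = mono-vanish S F (ℕₚ.<-trans (ℕₚ.n<1+n _) lt)
  mono-vanish (outside ∷ S) (false ∷ F) lt = mono-vanish S F lt
  mono-vanish (inside ∷ S)  (true ∷ F)  lt = mono-vanish S F (ℕₚ.≤-pred lt)
  mono-vanish (inside ∷ S)  (false ∷ F) lt = refl

  -- The number of e-sets T with S ⊆ T ⊆ F, where |F| = k, |S| = s and S ⊆ F.
  between : (k s e : ℕ) → Carrier
  between k       zero    zero    = 1#
  between zero    zero    (suc e) = 0#
  between (suc k) zero    (suc e) = between k zero (suc e) + between k zero e
  between k       (suc s) zero    = 0#
  between zero    (suc s) (suc e) = 0#
  between (suc k) (suc s) (suc e) = between k s e

  -- When S ⊆ F has s ≤ k elements and F has `suc k`, some element of F lies outside S; the summands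
  -- count the sets T that avoid it and those that contain it.
  between-pascal : ∀ {k s} e → s ≤ k → between (suc k) s e ≈ between k s e + between (suc k) (suc s) e
  between-pascal zero z≤n = sym (+-identityʳ 1#)
  between-pascal (suc e) z≤n = refl
  between-pascal zero (s≤s _) = sym (+-identityʳ 0#)
  between-pascal (suc e) (s≤s s≤k) = between-pascal e s≤k

  between-diagonal : ∀ {k s} → s ≤ k → between k s s ≈ 1#
  between-diagonal z≤n       = refl
  between-diagonal (s≤s s≤k) = between-diagonal s≤k

  -- The sum of the monomials x_T over the e-sets T ⊇ S, as a function on the cube.
  up : ∀ {n} (e : ℕ) → Subset n → Subset n → Carrier
  up e S F = between ∣ F ∣ ∣ S ∣ e · mono S F

  up-split : ∀ {n} e (S : Subset n) b F →
             up e (outside ∷ S) (b ∷ F) ≈ up e S F + up e (inside ∷ S) (b ∷ F)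
  up-split e S false F = sym (trans (+-congˡ (zeroʳ _)) (+-identityʳ _))
  up-split e S true F with ∣ S ∣ ≤? ∣ F ∣
  ... | yes le = trans (*-congʳ (between-pascal e le)) (distribʳ _ _ _)
  ... | no ¬le = trans (*-zeroʳ _ m≈0) (sym (+-zero (*-zeroʳ _ m≈0) (*-zeroʳ _ m≈0)))
    where m≈0 = mono-vanish S F (ℕₚ.≰⇒> ¬le)

  -- S itself is the only set of its size that contains S.
  up-diagonal : ∀ {n} (S F : Subset n) → up ∣ S ∣ S F ≈ mono S F
  up-diagonal S F with ∣ S ∣ ≤? ∣ F ∣
  ... | yes le = trans (*-congʳ (between-diagonal le)) (*-identityˡ _)
  ... | no ¬le = trans (*-zeroʳ _ m≈0) (sym m≈0)
    where m≈0 = mono-vanish S F (ℕₚ.≰⇒> ¬le)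

  -- Alternating sums over the subsets of T.

  -- Σ_{S ⊆ T} (−1)^|S| h S
  alternating : ∀ {n} → Subset n → (Subset n → Carrier) → Carrier
  alternating []            h = h []
  alternating (outside ∷ T) h = alternating T (h ∘ (outside ∷_))
  alternating (inside ∷ T)  h = alternating T (h ∘ (outside ∷_)) + - alternating T (h ∘ (inside ∷_))

  alternating-cong : ∀ {n} (T : Subset n) {f g} → (∀ S → f S ≈ g S) → alternating T f ≈ alternating T g
  alternating-cong []            eq = eq []
  alternating-cong (outside ∷ T) eq = alternating-cong T (eq ∘ (outside ∷_))
  alternating-cong (inside ∷ T)  eq =
    +-cong (alternating-cong T (eq ∘ (outside ∷_))) (-‿cong (alternating-cong T (eq ∘ (inside ∷_))))

  alternating-+ : ∀ {n} (T : Subset n) f g →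
                  alternating T (λ S → f S + g S) ≈ alternating T f + alternating T g
  alternating-+ []            f g = refl
  alternating-+ (outside ∷ T) f g = alternating-+ T (f ∘ (outside ∷_)) (g ∘ (outside ∷_))
  alternating-+ (inside ∷ T)  f g = trans
    (+-cong (alternating-+ T (f ∘ (outside ∷_)) (g ∘ (outside ∷_)))
            (trans (-‿cong (alternating-+ T (f ∘ (inside ∷_)) (g ∘ (inside ∷_)))) (sym (-‿+-comm _ _))))
    (solve 4 (λ a b c d → (a :+ b) :+ (c :+ d) := (a :+ c) :+ (b :+ d)) refl _ _ _ _)

  alternating-zero : ∀ {n} (T : Subset n) {f} → (∀ S → f S ≈ 0#) → alternating T f ≈ 0#
  alternating-zero []            eq = eq []
  alternating-zero (outside ∷ T) eq = alternating-zero T (eq ∘ (outside ∷_))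
  alternating-zero (inside ∷ T)  eq = +-zero (alternating-zero T (eq ∘ (outside ∷_)))
    (trans (-‿cong (alternating-zero T (eq ∘ (inside ∷_)))) -0#≈0#)

  -- By inclusion-exclusion the alternating sum counts the e-sets disjoint from T, and there is no room for one.
  alternating-up-zero : ∀ {n} e (T F : Subset n) → n < e ℕ.+ ∣ T ∣ → alternating T (λ S → up e S F) ≈ 0#
  alternating-up-zero zero    [] [] ()
  alternating-up-zero (suc e) [] [] _ = zeroˡ _
  alternating-up-zero {suc n} e (inside ∷ T) (b ∷ F) lt = begin
    alternating T (λ S → up e (outside ∷ S) (b ∷ F)) + - alternating T (λ S → up e (inside ∷ S) (b ∷ F))
      -- The sets through the first coordinate cancel, so both n and the size of T drop by one.
      ≈⟨ +-congʳ (trans (alternating-cong T (λ S → up-split e S b F)) (alternating-+ T _ _)) ⟩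
    (alternating T (λ S → up e S F) + alternating T (λ S → up e (inside ∷ S) (b ∷ F)))
      + - alternating T (λ S → up e (inside ∷ S) (b ∷ F))
      ≈⟨ x+y-y _ _ ⟩
    alternating T (λ S → up e S F)
      ≈⟨ alternating-up-zero e T F (ℕₚ.≤-pred (subst (suc n <_) (ℕₚ.+-suc e ∣ T ∣) lt)) ⟩
    0# ∎
  alternating-up-zero e (outside ∷ T) (b ∷ F) lt = begin
    alternating T (λ S → up e (outside ∷ S) (b ∷ F))
      ≈⟨ trans (alternating-cong T (λ S → up-split e S b F)) (alternating-+ T _ _) ⟩
    alternating T (λ S → up e S F) + alternating T (λ S → up e (inside ∷ S) (b ∷ F))
      ≈⟨ +-zero (alternating-up-zero e T F (ℕₚ.<-trans (ℕₚ.n<1+n _) lt)) (rest e b lt) ⟩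
    0# ∎
    where
    rest : ∀ e b → _ < e ℕ.+ ∣ T ∣ → alternating T (λ S → up e (inside ∷ S) (b ∷ F)) ≈ 0#
    rest e       false _  = alternating-zero T λ S → zeroʳ _
    rest zero    true  _  = alternating-zero T λ S → zeroˡ _
    -- All three arguments of `between` drop by one together, so the summand reduces to `up e S F`.
    rest (suc e) true  lt = alternating-up-zero e T F (ℕₚ.≤-pred lt)

  module _ {X I : Set} {g : I → X → Carrier} where

    alternating-span : ∀ {n} (T : Subset n) (h : Subset n → X → Carrier) →
                       (∀ S → ∣ S ∣ ≤ ∣ T ∣ → Span g (h S)) →
                       Span g (λ x → alternating T (λ S → h S x))
    alternating-span []            h hs = hs [] z≤n
    alternating-span (outside ∷ T) h hs = alternating-span T (h ∘ (outside ∷_)) (hs ∘ (outside ∷_))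
    alternating-span (inside ∷ T)  h hs =
      alternating-span T (h ∘ (outside ∷_)) (λ S le → hs (outside ∷ S) (ℕₚ.m≤n⇒m≤1+n le))
      +ₛ (-ₛ alternating-span T (h ∘ (inside ∷_)) (λ S le → hs (inside ∷ S) (s≤s le)))

    -- The term of S = T has coefficient ±1 and every other S ⊆ T is smaller, so `h T` can be solved
    -- for over any field.
    alternating-leading : ∀ {n} (T : Subset n) (h : Subset n → X → Carrier) →
                          (∀ S → ∣ S ∣ < ∣ T ∣ → Span g (h S)) →
                          Span g (λ x → alternating T (λ S → h S x)) → Span g (h T)
    alternating-leading []            h hs s = s
    alternating-leading (outside ∷ T) h hs s = alternating-leading T (h ∘ (outside ∷_)) (hs ∘ (outside ∷_)) s
    alternating-leading (inside ∷ T)  h hs s =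
      alternating-leading T (h ∘ (inside ∷_)) (λ S lt → hs (inside ∷ S) (s≤s lt))
        (respₛ (λ x → sym (x≈y+z⇒y≈x-z (trans (sym (x-y+y _ _)) (+-comm _ _))))
          (alternating-span T (h ∘ (outside ∷_)) (λ S le → hs (outside ∷ S) (s≤s le)) +ₛ (-ₛ s)))
      where
      x-y+y : ∀ x y → (x + - y) + y ≈ x
      x-y+y x y = trans (+-assoc x (- y) y) (trans (+-congˡ (-‿inverseˡ y)) (+-identityʳ x))

  -- Reduction of upward sums to ballot sets.

  -- For a ballot set S of size e, `up e S` is x_S itself; for smaller S it becomes a function of
  -- lower degree once restricted to a slice.
  Generator : (n e : ℕ) → Set
  Generator n e = Σ (Subset n) λ S → S ∈ ballot n e ⊎ ∣ S ∣ < e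

  generator : ∀ {n e} → Generator n e → Subset n → Carrier
  generator {e = e} (S , _) = up e S

  -- Strong induction on the size of T, with `m` as its bound. Once T has at least e elements, n <
  -- 2e ≤ e + ∣T∣ makes the alternating sum vanish, which expresses `up e T` through smaller sets.
  up-span-large : ∀ {n e} → n < e ℕ.+ e → ∀ m (T : Subset n) → ∣ T ∣ < m → Span (generator {n} {e}) (up e T)
  up-span-large {n} {e} lt (suc m) T T<m with ∣ T ∣ <? e
  ... | yes T<e = gen (T , inj₂ T<e)
  ... | no T≮e  = alternating-leading T (up e)
    (λ S S<T → up-span-large lt m S (ℕₚ.≤-trans S<T (ℕₚ.≤-pred T<m)))
    (respₛ (λ F → sym (alternating-up-zero e T F
              (ℕₚ.≤-trans lt (ℕₚ.+-monoʳ-≤ e (ℕₚ.≮⇒≥ T≮e))))) zeroₛ)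

  -- Induction on n. If T contains the first coordinate, `up e T` is that variable times an upward
  -- sum of order e - 1 in the remaining coordinates; otherwise `up-split` leaves such a term and a
  -- function of the tail. Arbitrary T are allowed because both terms are again upward sums, not
  -- single monomials.
  up-span : ∀ n e (T : Subset n) → Span (generator {n} {e}) (up e T)
  up-span zero zero    [] = gen ([] , inj₁ (here ≡.refl))
  up-span zero (suc e) [] = respₛ (λ { [] → sym (zeroˡ _) }) zeroₛ
  up-span (suc n) e T with e ℕ.+ e ≤? suc n
  ... | no ¬le = up-span-large (ℕₚ.≰⇒> ¬le) (suc ∣ T ∣) T ℕₚ.≤-refl
  ... | yes le = span T
    where
    [_] : Subset (suc n) → Carrier
    [ F ] = if head F then 1# else 0#

    span-inside : ∀ e → e ℕ.+ e ≤ suc n → ∀ T → Span (generator {suc n} {e}) (up e (inside ∷ T))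
    span-inside zero    _  T = respₛ (λ { (_ ∷ _) → sym (zeroˡ _) }) zeroₛ
    span-inside (suc e) le T = respₛ (λ F → sym (up-inside T F))
      (weighted-pullback [_] tail
        (λ { (S , inj₁ S∈) → respₛ (up-inside S) (gen (inside ∷ S , inj₁ (ballot-inside e le S∈)))
           ; (S , inj₂ S<) → respₛ (up-inside S) (gen (inside ∷ S , inj₂ (s≤s S<))) })
        (up-span n e T))
      where
      up-inside : ∀ S F → up (suc e) (inside ∷ S) F ≈ [ F ] · up e S (tail F)
      up-inside S (true ∷ F)  = sym (*-identityˡ _)
      up-inside S (false ∷ F) = trans (zeroʳ _) (sym (zeroˡ _))

    span : ∀ T → Span (generator {suc n} {e}) (up e T)
    span (inside ∷ T)  = span-inside e le T
    span (outside ∷ T) = respₛ (λ { (b ∷ F) → sym (up-split e T b F) })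
      (pullback tail lift (up-span n e T) +ₛ span-inside e le T)
      where
      -- A generator in fewer coordinates, read on the tail, is not itself a generator; it differs
      -- from one by an `inside` term already in the span.
      drop-coordinate : ∀ {S} → Span (generator {suc n} {e}) (up e (outside ∷ S)) →
                        Span (generator {suc n} {e}) (up e S ∘ tail)
      drop-coordinate {S} s = respₛ (λ { (b ∷ F) → sym (x≈y+z⇒y≈x-z (up-split e S b F)) })
        (s +ₛ (-ₛ span-inside e le S))

      lift : ∀ i → Span (generator {suc n} {e}) (generator {n} {e} i ∘ tail)
      lift (S , inj₁ S∈) = drop-coordinate (gen (outside ∷ S , inj₁ (ballot-outside e le S∈)))
      lift (S , inj₂ S<) = drop-coordinate (gen (outside ∷ S , inj₂ S<))

  -- Low-degree functions on a slice.

  Slice : (n k : ℕ) → Set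
  Slice n k = Σ (Subset n) λ F → ∣ F ∣ ≡ k

  module _ {n k : ℕ} where

    restrict : (Subset n → Carrier) → Slice n k → Carrier
    restrict φ = φ ∘ proj₁

    monos : (Bs : List (Subset n)) → Fin (length Bs) → Slice n k → Carrier
    monos Bs t = restrict (mono (List.lookup Bs t))

    monos-span : ∀ Bs {B} → B ∈ Bs → Span (monos Bs) (restrict (mono B))
    monos-span Bs B∈ =
      subst (λ B → Span (monos Bs) (restrict (mono B))) (≡.sym (lookup-index B∈)) (gen (index B∈))

    monos-weaken : ∀ {Bs Cs} → (∀ {B} → B ∈ Bs → B ∈ Cs) →
                   ∀ {φ} → Span (monos Bs) φ → Span (monos Cs) φ
    monos-weaken {Bs} {Cs} sub = pullback (λ F → F) (λ t → monos-span Cs (sub (∈-lookup t)))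

    ballot∈ballots≤ : ∀ e {S : Subset n} → S ∈ ballot n e → S ∈ ballots≤ n e
    ballot∈ballots≤ zero    S∈ = S∈
    ballot∈ballots≤ (suc e) S∈ = ∈-++⁺ˡ S∈

    -- Mutual recursion on e with `generator-slice-span`: for T of size e, x_T equals `up e T` and
    -- so reduces to generators, and those from smaller sets are multiples of monomials of degree
    -- below e.
    slice-span : ∀ e (T : Subset n) → ∣ T ∣ ≤ e → Span (monos (ballots≤ n e)) (restrict (mono T))

    -- On a slice, up e S is a constant multiple of the monomial x_S.
    generator-slice-span : ∀ e i → Span (monos (ballots≤ n e)) (restrict (generator {n} {e} i))
    generator-slice-span e (S , S∈) =
      respₛ (λ { (F , ≡.refl) → refl }) (between k ∣ S ∣ e *ₛ mono-span e S∈)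
      where
      mono-span : ∀ e → S ∈ ballot n e ⊎ ∣ S ∣ < e → Span (monos (ballots≤ n e)) (restrict (mono S))
      mono-span e       (inj₁ S∈) = monos-span (ballots≤ n e) (ballot∈ballots≤ e S∈)
      mono-span (suc e) (inj₂ S<) = monos-weaken (∈-++⁺ʳ (ballot n (suc e))) (slice-span e S (ℕₚ.≤-pred S<))

    slice-span e T le with ℕₚ.m≤n⇒m<n∨m≡n le
    slice-span (suc e) T _ | inj₁ lt = monos-weaken (∈-++⁺ʳ (ballot n (suc e))) (slice-span e T (ℕₚ.≤-pred lt))
    slice-span e       T _ | inj₂ eq =
      respₛ (λ (F , _) → trans (reflexive (cong (λ m → up m T F) (≡.sym eq))) (up-diagonal T F))
        (pullback proj₁ (generator-slice-span e) (up-span n e T))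

  -- From exponent vectors to set monomials.

  support : ∀ {n} → (Fin n → ℕ) → Subset n
  support {zero}  ε = []
  support {suc n} ε with ε zero
  ... | zero  = outside ∷ support (ε ∘ suc)
  ... | suc _ = inside ∷ support (ε ∘ suc)

  support-size : ∀ {n} (ε : Fin n → ℕ) → ∣ support ε ∣ ≤ expDeg 𝔽 ε
  support-size {zero}  ε = z≤n
  support-size {suc n} ε with ε zero
  ... | zero  = support-size (ε ∘ suc)
  ... | suc m = s≤s (ℕₚ.≤-trans (support-size (ε ∘ suc)) (ℕₚ.m≤n+m _ m))

  pow-one : ∀ m → pow 𝔽 1# m ≈ 1#
  pow-one zero    = refl
  pow-one (suc m) = trans (*-identityˡ _) (pow-one m)

  -- At 0 and 1 every positive power of x equals x, so only the support of the exponents matters.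
  evalMono-support : ∀ {n} (ε : Fin n → ℕ) (F : Subset n) →
                     evalMono 𝔽 ε (Vec.lookup (tabulate (charVec 𝔽 F))) ≈ mono (support ε) F
  evalMono-support ε [] = refl
  evalMono-support ε (b ∷ F) with ε zero
  evalMono-support ε (b ∷ F)     | zero  = trans (*-identityˡ _) (evalMono-support (ε ∘ suc) F)
  evalMono-support ε (true ∷ F)  | suc m =
    trans (*-congʳ (pow-one (suc m))) (trans (*-identityˡ _) (evalMono-support (ε ∘ suc) F))
  evalMono-support ε (false ∷ F) | suc m = *-zeroˡ _ (zeroˡ _)

  evalMono-++ : ∀ {m n} (ε : Fin (m ℕ.+ n) → ℕ) (u : Vec.Vec Carrier m) (v : Vec.Vec Carrier n) →
                evalMono 𝔽 ε (Vec.lookup (u Vec.++ v)) ≈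
                evalMono 𝔽 (ε ∘ (_↑ˡ n)) (Vec.lookup u) · evalMono 𝔽 (ε ∘ (m ↑ʳ_)) (Vec.lookup v)
  evalMono-++ ε []      v = sym (*-identityˡ _)
  evalMono-++ ε (x ∷ u) v = trans (*-congˡ (evalMono-++ (ε ∘ suc) u v)) (sym (*-assoc _ _ _))

  expDeg-++ : ∀ m {n} (ε : Fin (m ℕ.+ n) → ℕ) →
              expDeg 𝔽 ε ≡ expDeg 𝔽 (ε ∘ (_↑ˡ n)) ℕ.+ expDeg 𝔽 (ε ∘ (m ↑ʳ_))
  expDeg-++ zero    ε = ≡.refl
  expDeg-++ (suc m) ε = ≡.trans (cong (ε zero ℕ.+_) (expDeg-++ m (ε ∘ suc))) (≡.sym (ℕₚ.+-assoc (ε zero) _ _))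

  -- Matrices of small rank.

  -- A factorisation through N coordinates, serving as a certificate of rank at most N.
  bilinear : ∀ {N} {X : Set} (A B : Fin N → X → Carrier) → X → X → Carrier
  bilinear A B x y = sum λ t → A t x · B t y

  sum-splitAt : ∀ M {N} (f : Fin (M ℕ.+ N) → Carrier) →
                sum f ≈ sum (f ∘ (_↑ˡ N)) + sum (f ∘ (M ↑ʳ_))
  sum-splitAt zero    f = sym (+-identityˡ _)
  sum-splitAt (suc M) f = trans (+-congˡ (sum-splitAt M (f ∘ suc))) (sym (+-assoc _ _ _))

  bilinear-++ : ∀ {X : Set} {M N} (A B : Fin M → X → Carrier) (A′ B′ : Fin N → X → Carrier) x y →
                bilinear (A Vector.++ A′) (B Vector.++ B′) x y ≈ bilinear A B x y + bilinear A′ B′ x y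
  bilinear-++ {M = M} {N} A B A′ B′ x y = trans
    (sum-splitAt M λ t → (A Vector.++ A′) t x · (B Vector.++ B′) t y)
    (+-cong (sum-cong-≋ λ t → reflexive
              (≡.cong₂ (λ a b → a x · b y) (lookup-++ˡ A A′ t) (lookup-++ˡ B B′ t)))
            (sum-cong-≋ λ t → reflexive
              (≡.cong₂ (λ a b → a x · b y) (lookup-++ʳ A A′ t) (lookup-++ʳ B B′ t))))

  bilinear-+ʳ : ∀ {X : Set} {N} (A B B′ : Fin N → X → Carrier) x y →
                bilinear A (λ t y → B t y + B′ t y) x y ≈ bilinear A B x y + bilinear A B′ x y
  bilinear-+ʳ A B B′ x y = trans (sum-cong-≋ λ t → distribˡ (A t x) (B t y) (B′ t y))
                                 (∑-distrib-+ (λ t → A t x · B t y) (λ t → A t x · B′ t y))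

  bilinear-swap : ∀ {X : Set} {N} (A B : Fin N → X → Carrier) x y → bilinear A B x y ≈ bilinear B A y x
  bilinear-swap A B x y = sum-cong-≋ λ t → *-comm (A t x) (B t y)

  -- The coefficients of φ are absorbed into the second factor. The first factor is the fixed family
  -- `g`, so summing over many monomials does not increase the number of terms.
  tensor-bilinear : ∀ {X : Set} {N} {g : Fin N → X → Carrier} {φ} → Span g φ → (ψ : X → Carrier) →
                    Σ (Fin N → X → Carrier) λ h → ∀ x y → φ x · ψ y ≈ bilinear g h x y
  tensor-bilinear {g = g} {φ} s ψ with coefficients s
  ... | α , p = (λ t y → α t · ψ y) , λ x y → begin
    φ x · ψ y                            ≈⟨ *-congʳ (p x) ⟩
    sum (λ t → α t · g t x) · ψ y        ≈⟨ *-comm _ _ ⟩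
    ψ y · sum (λ t → α t · g t x)        ≈⟨ *-distribˡ-sum (ψ y) (λ t → α t · g t x) ⟩
    sum (λ t → ψ y · (α t · g t x))      ≈⟨ sum-cong-≋ (λ t →
      solve 3 (λ y a g → y :* (a :* g) := g :* (a :* y)) refl (ψ y) (α t) (g t x)) ⟩
    sum (λ t → g t x · (α t · ψ y))      ∎

  -- Each monomial of P has degree at most ⌊d/2⌋ in x or in y.
  eval₂-bilinear : ∀ {n d k} (P : Poly 𝔽 (n ℕ.+ n)) → DegreeAtMost 𝔽 d P →
    let g = monos {n} {k} (ballots≤ n (d / 2)) in
    Σ (Fin (length (ballots≤ n (d / 2))) → Slice n k → Carrier) λ h →
    Σ (Fin (length (ballots≤ n (d / 2))) → Slice n k → Carrier) λ h′ →
    ∀ F G → eval₂ 𝔽 P (proj₁ F) (proj₁ G) ≈ bilinear g h F G + bilinear h′ g F G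
  eval₂-bilinear {n} {d} {k} [] _ = (λ _ _ → 0#) , (λ _ _ → 0#) , λ F G → sym (+-zero
    (sum-zero (λ t → g t F · 0#) λ t → zeroʳ _) (sum-zero (λ t → 0# · g t G) λ t → zeroˡ _))
    where g = monos {n} {k} (ballots≤ n (d / 2))
  eval₂-bilinear {n} {d} {k} ((a , ε) ∷ P) (deg ∷ degs) with eval₂-bilinear {n} {d} {k} P degs
  ... | h , h′ , eq = add (half-≤ (expDeg 𝔽 εˡ) (expDeg 𝔽 εʳ) (subst (_≤ d) (expDeg-++ n ε) deg))
    where
    g = monos {n} {k} (ballots≤ n (d / 2))
    εˡ = ε ∘ (_↑ˡ n)
    εʳ = ε ∘ (n ↑ʳ_)
    φ ψ : Slice n k → Carrier
    φ = restrict (mono (support εˡ))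
    ψ = restrict (mono (support εʳ))

    monomial : ∀ F G →
      evalMono 𝔽 ε (Vec.lookup (tabulate (charVec 𝔽 (proj₁ F)) Vec.++ tabulate (charVec 𝔽 (proj₁ G))))
        ≈ φ F · ψ G
    monomial (F , _) (G , _) = trans (evalMono-++ ε (tabulate (charVec 𝔽 F)) (tabulate (charVec 𝔽 G)))
      (*-cong (evalMono-support εˡ F) (evalMono-support εʳ G))

    add : expDeg 𝔽 εˡ ≤ d / 2 ⊎ expDeg 𝔽 εʳ ≤ d / 2 → _
    add (inj₁ le) with tensor-bilinear (slice-span (d / 2) (support εˡ) (ℕₚ.≤-trans (support-size εˡ) le))
                                     (λ G → a · ψ G)
    ... | h₀ , eq₀ = (λ t G → h₀ t G + h t G) , h′ , λ F G → begin
      a · _ + _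
        ≈⟨ +-cong (trans (*-congˡ (monomial F G))
                         (solve 3 (λ a x y → a :* (x :* y) := x :* (a :* y)) refl a (φ F) (ψ G)))
                 (eq F G) ⟩
      φ F · (a · ψ G) + (bilinear g h F G + bilinear h′ g F G)
        ≈⟨ +-congʳ (eq₀ F G) ⟩
      bilinear g h₀ F G + (bilinear g h F G + bilinear h′ g F G)
        ≈⟨ +-assoc _ _ _ ⟨
      bilinear g h₀ F G + bilinear g h F G + bilinear h′ g F G
        ≈⟨ +-congʳ (bilinear-+ʳ g h₀ h F G) ⟨
      bilinear g (λ t G → h₀ t G + h t G) F G + bilinear h′ g F G ∎
    -- Low degree in y: the factorisation is taken with the arguments exchanged, hence the swaps
    -- below.
    add (inj₂ le) with tensor-bilinear (slice-span (d / 2) (support εʳ) (ℕₚ.≤-trans (support-size εʳ) le))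
                                     (λ F → a · φ F)
    ... | h₀ , eq₀ = h , (λ t F → h₀ t F + h′ t F) , λ F G → begin
      a · _ + _
        ≈⟨ +-cong (trans (*-congˡ (monomial F G))
                         (solve 3 (λ a x y → a :* (x :* y) := y :* (a :* x)) refl a (φ F) (ψ G)))
                 (eq F G) ⟩
      ψ G · (a · φ F) + (bilinear g h F G + bilinear h′ g F G)
        ≈⟨ +-congʳ (eq₀ G F) ⟩
      bilinear g h₀ G F + (bilinear g h F G + bilinear h′ g F G)
        ≈⟨ +-congˡ (+-congˡ (bilinear-swap h′ g F G)) ⟩
      bilinear g h₀ G F + (bilinear g h F G + bilinear g h′ G F)
        ≈⟨ solve 3 (λ a b c → a :+ (b :+ c) := b :+ (a :+ c)) refl
             (bilinear g h₀ G F) (bilinear g h F G) (bilinear g h′ G F) ⟩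
      bilinear g h F G + (bilinear g h₀ G F + bilinear g h′ G F)
        ≈⟨ +-congˡ (bilinear-+ʳ g h₀ h′ G F) ⟨
      bilinear g h F G + bilinear g (λ t F → h₀ t F + h′ t F) G F
        ≈⟨ +-congˡ (bilinear-swap g (λ t F → h₀ t F + h′ t F) G F) ⟩
      bilinear g h F G + bilinear (λ t F → h₀ t F + h′ t F) g F G ∎

  -- The rank of a diagonal matrix.

  -- Adding multiples of a pivot row p removes one rank-one term; as the other entries of that row
  -- vanish, the remaining minor is unchanged and stays diagonal.  Equality in 𝔽 need not be
  -- decidable, so vanishing off the diagonal is assumed only up to double negation.
  diagonal-rank : ∀ N h (A B : Fin N → Fin h → Carrier) →
                  (∀ i → ¬ (bilinear A B i i ≈ 0#)) →
                  (∀ i j → i ≢ j → ¬ ¬ (bilinear A B i j ≈ 0#)) → h ≤ N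
  diagonal-rank N       zero    A B diag off = z≤n
  diagonal-rank zero    (suc h) A B diag off = contradiction refl (diag zero)
  -- The goal is a decidable inequality, so it may be proved by contradiction. If no entry of
  -- `A zero` can serve as pivot, the first rank-one term vanishes and N terms already give the same
  -- matrix.
  diagonal-rank (suc N) (suc h) A B diag off = decidable-stable (suc h ≤? suc N) λ h≰N →
    let no-pivot : ∀ p → ¬ ¬ (A zero p ≈ 0#)
        no-pivot p a≉0 = h≰N (s≤s (eliminate p a≉0))
    in h≰N (ℕₚ.m≤n⇒m≤1+n (diagonal-rank N (suc h) (A ∘ suc) (B ∘ suc)
         (λ i rest≈0 → no-pivot i λ a≈0 → diag i (+-zero (*-zeroˡ _ a≈0) rest≈0))
         (λ i j i≢j rest≉0 → off i j i≢j λ M≈0 → no-pivot i λ a≈0 →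
           rest≉0 (trans (sym (trans (+-congʳ (*-zeroˡ _ a≈0)) (+-identityˡ _))) M≈0))))
    where
    eliminate : ∀ p → ¬ (A zero p ≈ 0#) → h ≤ N
    eliminate p a≉0 with inverse (A zero p) a≉0
    ... | a⁻¹ , aa⁻¹≈1 = diagonal-rank N h A′ B′
      (λ i M′≈0 → off p (punchIn p i) (punchInᵢ≢i p i ∘ ≡.sym) λ Mp≈0 →
        diag (punchIn p i) (trans (sym (minor i i Mp≈0)) M′≈0))
      (λ i j i≢j M′≉0 → off p (punchIn p j) (punchInᵢ≢i p j ∘ ≡.sym) λ Mp≈0 →
        off (punchIn p i) (punchIn p j) (i≢j ∘ punchIn-injective p i j) λ M≈0 →
        M′≉0 (trans (minor i j Mp≈0) M≈0))
      where
      r : Fin h → Carrier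
      -- Chosen so that the first coordinate of row `punchIn p i` is cancelled by that of row p.
      r i = - (A zero (punchIn p i) · a⁻¹)
      A′ B′ : Fin N → Fin h → Carrier
      A′ t i = A (suc t) (punchIn p i) + r i · A (suc t) p
      B′ t j = B (suc t) (punchIn p j)

      pivot-cancels : ∀ i → A zero (punchIn p i) + r i · A zero p ≈ 0#
      pivot-cancels i = begin
        a₀ + - (a₀ · a⁻¹) · A zero p    ≈⟨ +-congˡ (sym (-‿distribˡ-* _ _)) ⟩
        a₀ + - (a₀ · a⁻¹ · A zero p)    ≈⟨ +-congˡ (-‿cong
          (solve 3 (λ x y z → x :* y :* z := x :* (z :* y)) refl a₀ a⁻¹ (A zero p))) ⟩
        a₀ + - (a₀ · (A zero p · a⁻¹))  ≈⟨ +-congˡ (-‿cong (trans (*-congˡ aa⁻¹≈1) (*-identityʳ a₀))) ⟩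
        a₀ + - a₀                       ≈⟨ -‿inverseʳ a₀ ⟩
        0#                              ∎
        where a₀ = A zero (punchIn p i)

      minor : ∀ i j → bilinear A B p (punchIn p j) ≈ 0# →
              bilinear A′ B′ i j ≈ bilinear A B (punchIn p i) (punchIn p j)
      minor i j Mp≈0 = begin
        bilinear A′ B′ i j
          ≈⟨ sum-cong-≋ (λ t →
               solve 4 (λ x r y b → (x :+ r :* y) :* b := x :* b :+ r :* (y :* b)) refl
                 (A (suc t) i′) (r i) (A (suc t) p) (B (suc t) j′)) ⟩
        sum (λ t → A (suc t) i′ · B (suc t) j′ + r i · (A (suc t) p · B (suc t) j′))
          ≈⟨ ∑-distrib-+ (λ t → A (suc t) i′ · B (suc t) j′) (λ t → r i · (A (suc t) p · B (suc t) j′)) ⟩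
        s + sum (λ t → r i · (A (suc t) p · B (suc t) j′))
          ≈⟨ +-congˡ (*-distribˡ-sum (r i) (λ t → A (suc t) p · B (suc t) j′)) ⟨
        s + r i · s′
          ≈⟨ +-identityˡ _ ⟨
        0# + (s + r i · s′)
          ≈⟨ +-congʳ (*-zeroˡ _ (pivot-cancels i)) ⟨
        (A zero i′ + r i · A zero p) · b + (s + r i · s′)
          ≈⟨ solve 6 (λ x r y b s s′ → (x :+ r :* y) :* b :+ (s :+ r :* s′) := x :* b :+ s :+ r :* (y :* b :+ s′)) refl
                (A zero i′) (r i) (A zero p) b s s′ ⟩
        bilinear A B i′ j′ + r i · bilinear A B p j′
          ≈⟨ trans (+-congˡ (*-zeroʳ _ Mp≈0)) (+-identityʳ _) ⟩
        bilinear A B i′ j′ ∎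
        where
        i′ = punchIn p i
        j′ = punchIn p j
        b = B zero j′
        s = bilinear (A ∘ suc) (B ∘ suc) i′ j′
        s′ = bilinear (A ∘ suc) (B ∘ suc) p j′

-- The bound on the family.

theorem1p6 : {c ℓ : Level} (𝔽 : Field c ℓ) (n d k : ℕ) → d ≤ n →
    (ℋ : List (Subset n)) → Unique ℋ →
    (∀ F → F ∈ ℋ → ∣ F ∣ ≡ k) →
    Σ (Poly 𝔽 (n Data.Nat.+ n)) (λ P → DegreeAtMost 𝔽 d P
    × (∀ F → F ∈ ℋ → ¬ (Field._≈_ 𝔽 (eval₂ 𝔽 P F F) (Field.0# 𝔽)))
    × (∀ F G → F ∈ ℋ → G ∈ ℋ → ¬ (F ≡ G) → Field._≈_ 𝔽 (eval₂ 𝔽 P F G) (Field.0# 𝔽))) →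
    length ℋ ≤ 2 * (n C (d / 2))
theorem1p6 𝔽 n d k d≤n ℋ unique uniform (P , deg , diag , off) with eval₂-bilinear 𝔽 {n = n} {k = k} P deg
... | h , h′ , eq = begin
  length ℋ                                      ≤⟨ diagonal-rank 𝔽 _ (length ℋ) A B
      (λ i M≈0 → diag _ (∈-lookup i) (trans (factor i i) M≈0))
      (λ i j i≢j M≉0 → M≉0 (trans (sym (factor i j))
        (off _ _ (∈-lookup i) (∈-lookup j) (i≢j ∘ lookup-injective unique i j)))) ⟩
  N ℕ.+ N                                       ≤⟨ ℕₚ.+-mono-≤ N≤ N≤ ⟩
  n C e ℕ.+ n C e                               ≡⟨ cong (n C e ℕ.+_) (ℕₚ.+-identityʳ (n C e)) ⟨
  2 * (n C e)                                   ∎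
  where
  open ℕₚ.≤-Reasoning
  open Field 𝔽 using (Carrier; _≈_; sym; trans)
  e = d / 2
  N = length (ballots≤ n e)
  member : Fin (length ℋ) → Slice 𝔽 n k
  member i = List.lookup ℋ i , uniform _ (∈-lookup i)
  g = monos 𝔽 {n} {k} (ballots≤ n e)
  -- The two N-term factorisations are placed side by side and evaluated at positions in ℋ; distinct
  -- positions hold distinct sets, so the matrix is diagonal.
  A B : Fin (N ℕ.+ N) → Fin (length ℋ) → Carrier
  A t = (g Vector.++ h′) t ∘ member
  B t = (h Vector.++ g) t ∘ member
  factor : ∀ i j → eval₂ 𝔽 P (List.lookup ℋ i) (List.lookup ℋ j) ≈ bilinear 𝔽 A B i j
  factor i j = trans (eq (member i) (member j)) (sym (bilinear-++ 𝔽 g h h′ g (member i) (member j)))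
  N≤ : N ≤ n C e
  N≤ = length-ballots≤ n e (ℕₚ.m≤n⇒m≤1+n (begin
    e ℕ.+ e      ≡⟨ cong (e ℕ.+_) (ℕₚ.+-identityʳ e) ⟨
    2 * e        ≡⟨ ℕₚ.*-comm 2 e ⟩
    e * 2        ≤⟨ ℕ.m/n*n≤m d 2 ⟩
    d            ≤⟨ d≤n ⟩
    n            ∎))
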